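{- Let $\mathbf x = x_1x_2\ldots$ be an infinite word over a finite alphabet. The following are equivalent: (i) $\mathbf x$ is a Sturmian word; (ii) $r(n,\mathbf x) \le 2n+1$ for every $n \ge 1$, with equality for infinitely many $n$.
   Context: $p(n,\mathbf x)$ denotes the number of distinct factors of length $n$ of $\mathbf x$. A Sturmian word is an infinite word $\mathbf x$ with $p(n,\mathbf x) = n+1$ for every $n \ge 1$. With $x_i^j = x_i\cdots x_j$, $r(n,\mathbf x) = \min\{ m \ge 1 : x_i^{i+n-1} = x_{m-n+1}^{m} \text{ for some } i \text{ with } 1 \le i \le m-n\}$. -}

module Defs where

open import Data.Nat using (ℕ; suc; _+_; _∸_; _*_; _≤_; _<_)
open import Data.Fin using (Fin; toℕ)
open import Data.Vec using (Vec; tabulate)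
open import Data.List using (List; length)
open import Data.List.Relation.Unary.Unique.Propositional using (Unique)
open import Data.List.Membership.Propositional using (_∈_)
open import Data.Product using (Σ; ∃; _×_)
open import Relation.Binary.PropositionalEquality using (_≡_)
open import Function.Bundles using (_⇔_)

-- An infinite word over the finite alphabet Fin k.
-- Convention: the paper's x_i (1-based, i ≥ 1) is  x (i ∸ 1).
Word : ℕ → Set
Word k = ℕ → Fin k

-- factor x i n  =  x_i x_{i+1} ... x_{i+n-1}   (i is 1-based)
factor : ∀ {k} → Word k → ℕ → (n : ℕ) → Vec (Fin k) n
factor x i n = tabulate (λ j → x ((i ∸ 1) + toℕ j))

IsFactor : ∀ {k} → Word k → (n : ℕ) → Vec (Fin k) n → Set
IsFactor x n w = Σ ℕ λ i → 1 ≤ i × factor x i n ≡ w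

Complexity : ∀ {k} → Word k → ℕ → ℕ → Set
Complexity {k} x n m =
  Σ (List (Vec (Fin k) n)) λ ws →
    Unique ws × length ws ≡ m × (∀ w → w ∈ ws ⇔ IsFactor x n w)

Sturmian : ∀ {k} → Word k → Set
Sturmian x = ∀ n → 1 ≤ n → Complexity x n (suc n)

RCond : ∀ {k} → Word k → ℕ → ℕ → Set
RCond x n m = Σ ℕ λ i → 1 ≤ i × i ≤ m ∸ n × factor x i n ≡ factor x (suc (m ∸ n)) n

IsR : ∀ {k} → Word k → ℕ → ℕ → Set
IsR x n m = 1 ≤ m × RCond x n m × (∀ m′ → 1 ≤ m′ → RCond x n m′ → m ≤ m′)

{-# OPTIONS --safe #-}
module Submission where

-- Write R n for the least position whose block of length n occurred before, so that
-- r(n, x) = n + R n and the first R n blocks of length n are distinct.  If R (n + d) ≤ R n + d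
-- for all d, then every block of length n already occurs among the first R n ones.
-- If x is Sturmian, then R n ≤ n + 1, and when R n ≤ n slow growth would leave only R n < n + 1
-- factors; so the defect n + 1 − R n drops at some larger n, and reaches 0 after finitely many drops.
-- Conversely, if R m ≤ m + 1 for all m and R N = N + 1, then x has exactly N + 1 factors of
-- length N; as the complexity increases strictly from p(0) = 1 up to p(N) = N + 1, it is m + 1 at
-- every m ≤ N.

open import Defs
open import Data.Nat using (ℕ; suc; _+_; _*_; _≤_)
open import Data.Product using (Σ; _×_)
open import Function.Bundles using (_⇔_)

open import Data.Nat using (zero; _∸_; _<_; _⊔_; z≤n; s≤s; s≤s⁻¹)
open import Data.Nat.Properties
open import Data.Nat.Induction using (<-rec)
open import Data.Nat.Tactic.RingSolver using (solve-∀)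
open import Data.Fin using (Fin; toℕ; fromℕ<; inject₁) renaming (_≟_ to _≟ᶠ_)
open import Data.Fin.Properties using (toℕ-fromℕ<; toℕ<n; toℕ-inject₁)
open import Data.Vec using (Vec; tabulate) renaming (lookup to lookupᵛ)
open import Data.Vec.Properties using (≡-dec; tabulate-cong; lookup∘tabulate)
open import Data.List using (List; []; _∷_; length; map; filter; applyUpTo; deduplicate)
open import Data.List.Properties using (length-map; length-applyUpTo; length-deduplicate; filter-notAll)
open import Data.List.Relation.Unary.Any as Any using (here; there)
open import Data.List.Relation.Unary.All as All using (_∷_)
open import Data.List.Relation.Unary.AllPairs using (_∷_)
open import Data.List.Relation.Unary.Unique.Propositional using (Unique)
open import Data.List.Relation.Unary.Unique.Propositional.Properties using (applyUpTo⁺₁)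
open import Data.List.Relation.Unary.Unique.DecPropositional.Properties using (deduplicate-!)
open import Data.List.Membership.Propositional using (_∈_)
open import Data.List.Membership.Propositional.Properties
  using (∈-filter⁺; ∈-map⁺; ∈-applyUpTo⁺; ∈-applyUpTo⁻; ∈-deduplicate⁺; ∈-deduplicate⁻)
open import Data.Product using (∃; _,_; proj₁; proj₂)
open import Data.Sum using (inj₁; inj₂)
open import Function using (_∘_)
open import Function.Bundles using (mk⇔; Equivalence)
open import Relation.Binary.Definitions using (DecidableEquality)
open import Relation.Binary.PropositionalEquality
open import Relation.Nullary using (¬_; yes; no; ¬?; contradiction; decidable-stable)
open import Relation.Nullary.Decidable using (map′)
open import Relation.Unary using (Decidable)

-- Finite search and counting in lists

least : {P : ℕ → Set} → Decidable P → ∀ n → P n →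
        ∃ λ p → p ≤ n × P p × (∀ q → P q → p ≤ q)
least P? n Pn with P? 0
... | yes P0 = 0 , z≤n , P0 , λ _ _ → z≤n
least P? zero Pn | no ¬P0 = contradiction Pn ¬P0
least P? (suc n) Pn | no ¬P0 with least (P? ∘ suc) n Pn
... | p , p≤n , Pp , min =
  suc p , s≤s p≤n , Pp , λ { zero P0 → contradiction P0 ¬P0 ; (suc q) Pq → s≤s (min q Pq) }

-- Serves to bound, by one number, positions at which all the finitely many factors of a given
-- length occur.
boundedWitnesses : {A : Set} {P : A → ℕ → Set} (ws : List A) → (∀ {w} → w ∈ ws → ∃ (P w)) →
                   ∃ λ B → ∀ {w} → w ∈ ws → ∃ λ p → p ≤ B × P w p
boundedWitnesses [] f = 0 , λ ()
boundedWitnesses (w ∷ ws) f with f (here refl) | boundedWitnesses ws (f ∘ there)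
... | p , Pwp | B , g = p ⊔ B , λ where
  (here refl) → p , m≤m⊔n p B , Pwp
  (there w∈)  → let q , q≤B , Pwq = g w∈ in q , ≤-trans q≤B (m≤n⊔m p B) , Pwq

module _ {A : Set} (_≟_ : DecidableEquality A) where

  remove : A → List A → List A
  remove a = filter (λ b → ¬? (a ≟ b))

  length-remove : ∀ {a} {ys : List A} → a ∈ ys → length (remove a ys) < length ys
  length-remove {a} {ys} a∈ys =
    filter-notAll (λ b → ¬? (a ≟ b)) ys (Any.map (λ eq ne → ne eq) a∈ys)

  ∈-remove : ∀ {a b} {ys : List A} → b ∈ ys → ¬ a ≡ b → b ∈ remove a ys
  ∈-remove {a} = ∈-filter⁺ (λ b → ¬? (a ≟ b))

  -- Removing the head `x` from `ys` shortens `ys`, and by uniqueness the remaining list still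
  -- contains the tail.
  Unique-⊆⇒length≤ : ∀ {xs ys : List A} → Unique xs → (∀ {v} → v ∈ xs → v ∈ ys) → length xs ≤ length ys
  Unique-⊆⇒length≤ {[]}     _        _   = z≤n
  Unique-⊆⇒length≤ {x ∷ xs} (x∉ ∷ u) sub = ≤-trans
    (s≤s (Unique-⊆⇒length≤ u λ v∈ → ∈-remove (sub (there v∈)) (All.lookup x∉ v∈)))
    (length-remove (sub (here refl)))

module _ {A B : Set} (_≟ᴬ_ : DecidableEquality A) (_≟ᴮ_ : DecidableEquality B) where

  -- Pigeonhole: if two distinct elements had the same image, dropping one would leave a shorter
  -- list that still maps onto `ys`.
  surjective⇒injective : ∀ (g : A → B) {xs ys} → Unique ys →
    (∀ {y} → y ∈ ys → ∃ λ x → x ∈ xs × y ≡ g x) → length xs ≤ length ys →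
    ∀ {a b} → a ∈ xs → b ∈ xs → g a ≡ g b → a ≡ b
  surjective⇒injective g {xs} {ys} u surj len {a} {b} a∈ b∈ ga≡gb =
    decidable-stable (a ≟ᴬ b) λ a≢b → <-irrefl refl (begin-strict
      length ys                        ≤⟨ Unique-⊆⇒length≤ _≟ᴮ_ u (covered a≢b) ⟩
      length (map g (remove _≟ᴬ_ a xs)) ≡⟨ length-map g (remove _≟ᴬ_ a xs) ⟩
      length (remove _≟ᴬ_ a xs)        <⟨ length-remove _≟ᴬ_ a∈ ⟩
      length xs                        ≤⟨ len ⟩
      length ys                        ∎)
    where
    open ≤-Reasoning
    covered : ¬ a ≡ b → ∀ {y} → y ∈ ys → y ∈ map g (remove _≟ᴬ_ a xs)
    covered a≢b y∈ with surj y∈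
    ... | x , x∈ , refl with a ≟ᴬ x
    ...   | yes refl = subst (_∈ map g (remove _≟ᴬ_ a xs)) (sym ga≡gb) (∈-map⁺ g (∈-remove _≟ᴬ_ b∈ a≢b))
    ...   | no a≢x   = ∈-map⁺ g (∈-remove _≟ᴬ_ x∈ a≢x)

-- Blocks and letterwise agreement

_≟ᵛ_ : ∀ {k n} → DecidableEquality (Vec (Fin k) n)
_≟ᵛ_ = ≡-dec _≟ᶠ_

truncate : ∀ {k n} → Vec (Fin k) (suc n) → Vec (Fin k) n
truncate w = tabulate (lookupᵛ w ∘ inject₁)

module _ {k} (x : Word k) where

  -- Positions are 0-based from here on.
  block : ℕ → (n : ℕ) → Vec (Fin k) n
  block p n = factor x (suc p) n

  -- Unlike equality of vectors, this form restricts and shifts without transport along equations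
  -- between lengths.
  Agree : ℕ → ℕ → ℕ → Set
  Agree n p q = ∀ {j} → j < n → x (p + j) ≡ x (q + j)

  Agree⇒block≡ : ∀ {n p q} → Agree n p q → block p n ≡ block q n
  Agree⇒block≡ a = tabulate-cong λ i → a (toℕ<n i)

  block≡⇒Agree : ∀ {n p q} → block p n ≡ block q n → Agree n p q
  block≡⇒Agree {n} {p} {q} eq {j} j<n = begin
    x (p + j)                   ≡⟨ at p ⟨
    lookupᵛ (block p n) (fromℕ< j<n) ≡⟨ cong (λ w → lookupᵛ w (fromℕ< j<n)) eq ⟩
    lookupᵛ (block q n) (fromℕ< j<n) ≡⟨ at q ⟩
    x (q + j)                   ∎
    where
    open ≡-Reasoning
    at : ∀ r → lookupᵛ (block r n) (fromℕ< j<n) ≡ x (r + j)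
    at r = trans (lookup∘tabulate (λ i → x (r + toℕ i)) (fromℕ< j<n)) (cong (λ i → x (r + i)) (toℕ-fromℕ< j<n))

  truncate-block : ∀ p n → truncate (block p (suc n)) ≡ block p n
  truncate-block p n = tabulate-cong λ i →
    trans (lookup∘tabulate (λ i → x (p + toℕ i)) (inject₁ i)) (cong (λ j → x (p + j)) (toℕ-inject₁ i))

  Agree-≤ : ∀ {m n p q} → m ≤ n → Agree n p q → Agree m p q
  Agree-≤ m≤n a j<m = a (≤-trans j<m m≤n)

  Agree-shift : ∀ {m n p q} d → d + m ≤ n → Agree n p q → Agree m (p + d) (q + d)
  Agree-shift {p = p} {q} d d+m≤n a {j} j<m =
    trans (cong x (+-assoc p d j))
      (trans (a (≤-trans (+-monoʳ-< d j<m) d+m≤n)) (cong x (sym (+-assoc q d j))))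

  -- First repeats and their relation to r

  Covered : ℕ → ℕ → ℕ → Set
  Covered n b p = ∃ λ q → q < b × Agree n q p

  Repeats : ℕ → ℕ → Set
  Repeats n p = Covered n p p

  repeats? : ∀ n → Decidable (Repeats n)
  repeats? n p = anyUpTo? (λ q → map′ block≡⇒Agree Agree⇒block≡ (block q n ≟ᵛ block p n)) p

  -- Amounts to r(n, x) = n + p, but free of the truncated subtraction in `RCond`.
  FirstRepeat : ℕ → ℕ → Set
  FirstRepeat n p = Repeats n p × (∀ q → Repeats n q → p ≤ q)

  -- If m < n, then `m ∸ n` is 0 and leaves no room for i.
  RCond⇒≤ : ∀ {n m} → RCond x n m → n ≤ m
  RCond⇒≤ (_ , 1≤i , i≤ , _) =
    <⇒≤ (m∸n≢0⇒n<m λ eq → contradiction (subst (1 ≤_) eq (≤-trans 1≤i i≤)) λ ())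

  RCond⇒Repeats : ∀ {n m} → RCond x n m → Repeats n (m ∸ n)
  RCond⇒Repeats (suc i , _ , i<p , eq) = i , i<p , block≡⇒Agree eq

  Repeats⇒RCond : ∀ {n p} → Repeats n p → RCond x n (n + p)
  Repeats⇒RCond {n} {p} (q , q<p , a) rewrite m+n∸m≡n n p = suc q , s≤s z≤n , q<p , Agree⇒block≡ a

  FirstRepeat⇒IsR : ∀ {n p} → FirstRepeat n p → IsR x n (n + p)
  FirstRepeat⇒IsR {n} {p} (rep@(q , q<p , _) , min) =
    ≤-trans (≤-trans (s≤s z≤n) q<p) (m≤n+m p n) , Repeats⇒RCond rep , λ m _ rc →
      ≤-trans (+-monoʳ-≤ n (min (m ∸ n) (RCond⇒Repeats rc))) (≤-reflexive (m+[n∸m]≡n (RCond⇒≤ rc)))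

  IsR⇒FirstRepeat : ∀ {n p} → IsR x n (n + p) → FirstRepeat n p
  IsR⇒FirstRepeat {n} {p} (_ , rc , min) =
    subst (Repeats n) (m+n∸m≡n n p) (RCond⇒Repeats rc) ,
    λ { q rep@(_ , q′<q , _) →
        +-cancelˡ-≤ n p q (min (n + q) (≤-trans (≤-trans (s≤s z≤n) q′<q) (m≤n+m q n)) (Repeats⇒RCond rep)) }

  -- Both conditions of the theorem speak of n ≥ 1 only; this value extends R to length 0 and
  -- respects the bound n + 1.
  FirstRepeat-0 : FirstRepeat 0 1
  FirstRepeat-0 = (0 , s≤s z≤n , λ ()) , λ { _ (_ , q<p , _) → ≤-trans (s≤s z≤n) q<p }

  blocks : ℕ → (n : ℕ) → List (Vec (Fin k) n)
  blocks b n = applyUpTo (λ p → block p n) b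

  Covered⇒∈blocks : ∀ {n b p} → Covered n b p → block p n ∈ blocks b n
  Covered⇒∈blocks (q , q<b , a) = subst (_∈ _) (Agree⇒block≡ a) (∈-applyUpTo⁺ _ q<b)

  ∈blocks⇒block : ∀ {n b w} → w ∈ blocks b n → ∃ λ p → w ≡ block p n
  ∈blocks⇒block {n} w∈ = let p , _ , eq = ∈-applyUpTo⁻ (λ p → block p n) w∈ in p , eq

  -- Slow growth of R

  module _ (R : ℕ → ℕ) (first : ∀ n → FirstRepeat n (R n)) where

    -- A repeat of a block is also a repeat of each of its prefixes.
    R-mono : ∀ {m n} → m ≤ n → R m ≤ R n
    R-mono {m} {n} m≤n with first n
    ... | (q , q< , a) , _ = proj₂ (first m) (R n) (q , q< , Agree-≤ m≤n a)

    -- Passing from M to M + 1, the new positions below R (M + 1) lie in the part already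
    -- covered by the slow growth of R, and those from R (M + 1) on are copies of earlier ones.
    slowGrowth⇒Covered : ∀ n e → (∀ d → d ≤ e → R (d + n) ≤ R n + d) →
                         ∀ p → p ≤ R (e + n) + e → Covered n (R n) p
    slowGrowth⇒Covered n zero slow p p≤ with m≤n⇒m<n∨m≡n (subst (p ≤_) (+-identityʳ _) p≤)
    ... | inj₁ p<R  = p , p<R , λ _ → refl
    ... | inj₂ refl = proj₁ (first n)
    slowGrowth⇒Covered n (suc e) slow = <-rec _ step
      where
      M = suc e + n
      step : ∀ p → (∀ {q} → q < p → q ≤ R M + suc e → Covered n (R n) q) →
             p ≤ R M + suc e → Covered n (R n) p
      step p rec p≤ with p <? R M
      ... | yes p<R = slowGrowth⇒Covered n e (λ d d≤e → slow d (m≤n⇒m≤1+n d≤e)) p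
        -- The strict inequality p < `R M` pays for the step from `suc e` down to `e`.
        (s≤s⁻¹ (begin
          suc p             ≤⟨ p<R ⟩
          R M               ≤⟨ slow (suc e) ≤-refl ⟩
          R n + suc e       ≤⟨ +-monoˡ-≤ (suc e) (R-mono (m≤n+m n e)) ⟩
          R (e + n) + suc e ≡⟨ +-suc _ e ⟩
          suc (R (e + n) + e) ∎))
        where
        open ≤-Reasoning
      ... | no p≮R with first M
      ...   | (q , q<R , a) , _ = let r , r<R , a′ = earlier in
                r , r<R , λ j< → trans (a′ j<) (trans (copy j<) (cong (λ i → x (i + _)) R+d≡p))
        where
        d = p ∸ R M
        R+d≡p : R M + d ≡ p
        R+d≡p = m+[n∸m]≡n (≮⇒≥ p≮R)
        d≤ : d ≤ suc e
        d≤ = +-cancelˡ-≤ (R M) d (suc e) (subst (_≤ R M + suc e) (sym R+d≡p) p≤)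
        q+d<p : q + d < p
        q+d<p = subst (q + d <_) R+d≡p (+-monoˡ-< d q<R)
        earlier : Covered n (R n) (q + d)
        earlier = rec q+d<p (≤-trans (<⇒≤ q+d<p) p≤)
        -- The repeat at `R M` has length `suc e + n`, so a shift by d ≤ `suc e` leaves at least n
        -- agreeing letters.
        copy : Agree n (q + d) (R M + d)
        copy = Agree-shift {q = R M} d (+-monoˡ-≤ n d≤) a

  -- From Sturmian to the bound on r and its attainment

  module SturmianCase (sturmian : Sturmian x) where

    block∈ : ∀ n (1≤n : 1 ≤ n) p → block p n ∈ proj₁ (sturmian n 1≤n)
    block∈ n 1≤n p = let _ , _ , _ , iff = sturmian n 1≤n in
      Equivalence.from (iff _) (suc p , s≤s z≤n , refl)

    -- Pigeonhole for n ≥ 1: the n + 2 blocks at positions 0 to n + 1 cannot be distinct when there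
    -- are only n + 1 factors.
    exists-first : ∀ n → ∃ λ p → FirstRepeat n p × p ≤ suc n
    exists-first zero = 1 , FirstRepeat-0 , ≤-refl
    exists-first n@(suc _) with anyUpTo? (repeats? n) (suc (suc n))
    ... | yes (p , p≤ , rep) = let q , q≤p , rep′ , min = least (repeats? n) p rep in
      q , (rep′ , min) , ≤-trans q≤p (s≤s⁻¹ p≤)
    ... | no ¬rep = let ws , _ , len , _ = sturmian n (s≤s z≤n) in
      contradiction
        (subst₂ _≤_ (length-applyUpTo (λ p → block p n) (suc (suc n))) len
          (Unique-⊆⇒length≤ _≟ᵛ_
            (applyUpTo⁺₁ (λ p → block p n) (suc (suc n)) λ i<j j< eq → ¬rep (_ , j< , _ , i<j , block≡⇒Agree eq))
            λ v∈ → let p , eq = ∈blocks⇒block {n} {suc (suc n)} v∈ in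
              subst (_∈ ws) (sym eq) (block∈ n (s≤s z≤n) p)))
        1+n≰n

    R : ℕ → ℕ
    R n = proj₁ (exists-first n)

    first : ∀ n → FirstRepeat n (R n)
    first n = proj₁ (proj₂ (exists-first n))

    R≤ : ∀ n → R n ≤ suc n
    R≤ n = proj₂ (proj₂ (exists-first n))

    -- Choose B so that all n + 1 factors start at or before B; they cannot all be among b ≤ n
    -- blocks. A finite B keeps the search in `fastGrowth` bounded, hence decidable.
    ¬all-covered : ∀ n → 1 ≤ n → ∀ {b} → b ≤ n →
                   ∃ λ B → ¬ (∀ p → p ≤ B → Covered n b p)
    ¬all-covered n 1≤n {b} b≤n with sturmian n 1≤n
    ... | ws , u , len , iff with boundedWitnesses {P = λ w p → block p n ≡ w} ws position
      where
      position : ∀ {w} → w ∈ ws → ∃ λ p → block p n ≡ w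
      position w∈ with Equivalence.to (iff _) w∈
      ... | suc p , _ , eq = p , eq
    ... | B , occurs = B , λ cov → 1+n≰n (begin
      suc n                ≡⟨ len ⟨
      length ws            ≤⟨ Unique-⊆⇒length≤ _≟ᵛ_ u (λ w∈ → let p , p≤B , eq = occurs w∈ in
                                subst (_∈ blocks b n) eq (Covered⇒∈blocks (cov p p≤B))) ⟩
      length (blocks b n)  ≡⟨ length-applyUpTo (λ p → block p n) b ⟩
      b                    ≤⟨ b≤n ⟩
      n                    ∎)
      where open ≤-Reasoning

    fastGrowth : ∀ n → 1 ≤ n → R n ≤ n → ∃ λ d → R n + d < R (d + n)
    fastGrowth n 1≤n Rn≤n with ¬all-covered n 1≤n Rn≤n
    ... | B , ¬cov with anyUpTo? (λ d → R n + d <? R (d + n)) (suc B)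
    ...   | yes (d , _ , fast) = d , fast
    ...   | no ¬fast = contradiction
      -- With no fast d up to B, every position up to `R (B + n) + B`, hence up to B, is covered.
      (λ p p≤B → slowGrowth⇒Covered R first n B
        (λ d d≤B → ≮⇒≥ λ fast → ¬fast (d , s≤s d≤B , fast)) p (≤-trans p≤B (m≤n+m B _)))
      ¬cov

    Attains : ℕ → Set
    Attains N = ∃ λ m → N ≤ m × 1 ≤ m × R m ≡ suc m

    -- Descent on the defect n + 1 − R n.
    attains : ∀ N c n → N ≤ n → 1 ≤ n → R n + c ≡ suc n → Attains N
    attains N = <-rec _ step
      where
      open ≤-Reasoning
      swap : ∀ a b c → a + (b + c) ≡ b + a + c
      swap = solve-∀
      step : ∀ c → (∀ {c′} → c′ < c → ∀ n → N ≤ n → 1 ≤ n → R n + c′ ≡ suc n → Attains N) →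
             ∀ n → N ≤ n → 1 ≤ n → R n + c ≡ suc n → Attains N
      step zero    rec n N≤n 1≤n eq = n , N≤n , 1≤n , trans (sym (+-identityʳ _)) eq
      step (suc c) rec n N≤n 1≤n eq
        with d , fast ← fastGrowth n 1≤n (subst (R n ≤_) (suc-injective (trans (sym (+-suc (R n) c)) eq)) (m≤m+n (R n) c))
        = rec c′<1+c m (≤-trans N≤n (m≤n+m n d)) (≤-trans 1≤n (m≤n+m n d)) eq′
        where
        m = d + n
        c′ = suc m ∸ R m
        eq′ : R m + c′ ≡ suc m
        eq′ = m+[n∸m]≡n (R≤ m)
        c′<1+c : c′ < suc c
        -- From n to d + n the bound n + 1 rises by d and R by more than d, so the defect shrinks.
        c′<1+c = +-cancelˡ-< (R n + d) c′ (suc c) (begin-strict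
          R n + d + c′      <⟨ +-monoˡ-< c′ fast ⟩
          R m + c′          ≡⟨ eq′ ⟩
          suc (d + n)       ≡⟨ +-suc d n ⟨
          d + suc n         ≡⟨ cong (d +_) eq ⟨
          d + (R n + suc c) ≡⟨ swap d (R n) (suc c) ⟩
          R n + d + suc c   ∎)

  -- From the bound and one equality to the complexity

  module RepeatCase (R : ℕ → ℕ) (first : ∀ n → FirstRepeat n (R n)) (R≤ : ∀ n → R n ≤ suc n)
                    {N} (RN : R N ≡ suc N) where

    -- As R N = N + 1, the bound at d + N reads `R (d + N) ≤ R N + d`, which is slow growth for
    -- every d; taking e = p reaches position p.
    all-covered : ∀ p → Covered N (suc N) p
    all-covered p = subst (λ b → Covered N b p) RN
      (slowGrowth⇒Covered R first N p
        (λ d _ → ≤-trans (R≤ (d + N)) (≤-reflexive (trans (cong suc (+-comm d N)) (cong (_+ d) (sym RN)))))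
        p (m≤n+m p _))

    -- For m ≤ N this is the complete list of factors of length m, since coverage at length N
    -- restricts to prefixes.
    factors : (m : ℕ) → List (Vec (Fin k) m)
    factors m = deduplicate _≟ᵛ_ (blocks (suc N) m)

    block∈factors : ∀ {m} → m ≤ N → ∀ p → block p m ∈ factors m
    block∈factors m≤N p = let q , q< , a = all-covered p in
      ∈-deduplicate⁺ _≟ᵛ_ (Covered⇒∈blocks (q , q< , Agree-≤ m≤N a))

    ∈factors⇒block : ∀ {m w} → w ∈ factors m → ∃ λ p → w ≡ block p m
    ∈factors⇒block {m} w∈ = ∈blocks⇒block {m} {suc N} (∈-deduplicate⁻ _≟ᵛ_ (blocks (suc N) m) w∈)

    factors-! : ∀ m → Unique (factors m)
    factors-! m = deduplicate-! _≟ᵛ_ (blocks (suc N) m)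

    -- After gaining a letter on the right, drop one on the left: agreement of length m holds one
    -- position further on and can be extended again.
    Agree-extend : ∀ {m} → (∀ p q → Agree m p q → Agree (suc m) p q) →
                   ∀ e p q → Agree m p q → Agree (e + m) p q
    Agree-extend ext zero    p q a = a
    Agree-extend {m} ext (suc e) p q a {zero} _ = ext p q a (s≤s z≤n)
    Agree-extend {m} ext (suc e) p q a {suc j} (s≤s j<) =
      trans (cong x (sym (shift p)))
        (trans (Agree-extend ext e (p + 1) (q + 1) (Agree-shift 1 ≤-refl (ext p q a)) j<)
          (cong x (shift q)))
      where
      shift : ∀ r → r + 1 + j ≡ r + suc j
      shift r = +-assoc r 1 j

    -- If the number of factors did not grow, each factor of length m would determine its
    -- extension of length N, so the repetition at R m would already be one of length N.
    length-factors-< : ∀ {m} → m < N → length (factors m) < length (factors (suc m))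
    length-factors-< {m} m<N = ≰⇒> λ len →
      <⇒≱ m<N (s≤s⁻¹ (begin
        suc N  ≡⟨ RN ⟨
        R N    ≤⟨ proj₂ (first N) (R m) (let q , q< , a = proj₁ (first m) in
                    q , q< , subst (λ n → Agree n q (R m)) (m∸n+n≡m (<⇒≤ m<N))
                      (Agree-extend (extend len) (N ∸ m) q (R m) a)) ⟩
        R m    ≤⟨ R≤ m ⟩
        suc m  ∎))
      where
      open ≤-Reasoning
      -- Truncation maps `factors (suc m)` onto `factors m`; if the source is no longer than the
      -- target, it is injective there.
      extend : length (factors (suc m)) ≤ length (factors m) → ∀ p q → Agree m p q → Agree (suc m) p q
      extend len p q a = block≡⇒Agree (surjective⇒injective _≟ᵛ_ _≟ᵛ_ truncate (factors-! m)
        (λ y∈ → let r , eq = ∈factors⇒block y∈ in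
          block r (suc m) , block∈factors m<N r , trans eq (sym (truncate-block r m)))
        len
        (block∈factors m<N p) (block∈factors m<N q)
        (trans (truncate-block p m) (trans (Agree⇒block≡ a) (sym (truncate-block q m)))))

    length-factors-≥ : ∀ m → m ≤ N → suc m ≤ length (factors m)
    length-factors-≥ zero    _   = s≤s z≤n
    length-factors-≥ (suc m) m<N = ≤-trans (s≤s (length-factors-≥ m (<⇒≤ m<N))) (length-factors-< m<N)

    length-factors-+ : ∀ e m → e + m ≤ N → e + length (factors m) ≤ length (factors (e + m))
    length-factors-+ zero    m _ = ≤-refl
    length-factors-+ (suc e) m h = ≤-trans (s≤s (length-factors-+ e m (<⇒≤ h))) (length-factors-< h)

    -- Counting down from N: at most N + 1 factors exist there, and each of the N ∸ m steps from m
    -- to N adds at least one.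
    length-factors-≤ : ∀ {m} → m ≤ N → length (factors m) ≤ suc m
    length-factors-≤ {m} m≤N = +-cancelˡ-≤ (N ∸ m) _ _ (begin
      N ∸ m + length (factors m)   ≤⟨ length-factors-+ (N ∸ m) m (≤-reflexive e+m≡N) ⟩
      length (factors (N ∸ m + m)) ≤⟨ length-deduplicate _≟ᵛ_ (blocks (suc N) _) ⟩
      length (blocks (suc N) (N ∸ m + m)) ≡⟨ length-applyUpTo (λ p → block p (N ∸ m + m)) (suc N) ⟩
      suc N                        ≡⟨ cong suc e+m≡N ⟨
      suc (N ∸ m + m)              ≡⟨ +-suc (N ∸ m) m ⟨
      N ∸ m + suc m                ∎)
      where
      open ≤-Reasoning
      e+m≡N = m∸n+n≡m m≤N

    complexity : ∀ {m} → m ≤ N → Complexity x m (suc m)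
    complexity {m} m≤N =
      factors m , factors-! m , ≤-antisym (length-factors-≤ m≤N) (length-factors-≥ m m≤N) , λ w →
        mk⇔ (λ w∈ → let p , eq = ∈factors⇒block w∈ in suc p , s≤s z≤n , sym eq)
            λ { (suc p , _ , refl) → block∈factors m≤N p }

-- Assembling the equivalence

n+[1+n]≡2n+1 : ∀ n → n + suc n ≡ 2 * n + 1
n+[1+n]≡2n+1 = solve-∀

theorem2p4 : ∀ {k} (x : Word k) →
    Sturmian x ⇔
    ((∀ n → 1 ≤ n → Σ ℕ λ m → IsR x n m × m ≤ 2 * n + 1)
    × (∀ N → Σ ℕ λ n → N ≤ n × 1 ≤ n × IsR x n (2 * n + 1)))
theorem2p4 x = mk⇔ forward backward
  where
  Repetitive = (∀ n → 1 ≤ n → Σ ℕ λ m → IsR x n m × m ≤ 2 * n + 1)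
             × (∀ N → Σ ℕ λ n → N ≤ n × 1 ≤ n × IsR x n (2 * n + 1))

  forward : Sturmian x → Repetitive
  forward sturmian =
    (λ n _ → n + R n , FirstRepeat⇒IsR x (first n) ,
      ≤-trans (+-monoʳ-≤ n (R≤ n)) (≤-reflexive (n+[1+n]≡2n+1 n))) ,
    -- Starting at `suc N` keeps the length positive even when N = 0.
    λ N → let n , N<n , 1≤n , Rn = attains (suc N) _ (suc N) ≤-refl (s≤s z≤n) (m+[n∸m]≡n (R≤ (suc N))) in
      n , <⇒≤ N<n , 1≤n ,
      subst (IsR x n) (trans (cong (n +_) Rn) (n+[1+n]≡2n+1 n)) (FirstRepeat⇒IsR x (first n))
    where
    open SturmianCase x sturmian

  backward : Repetitive → Sturmian x
  -- Equality at a single N ≥ n settles the complexity at n.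
  backward (bounded , often) n _ with often n
  ... | N , n≤N , _ , isR = RepeatCase.complexity x R first R≤ RN n≤N
    where
    exists-first : ∀ n → ∃ λ p → FirstRepeat x n p × p ≤ suc n
    exists-first zero = 1 , FirstRepeat-0 x , ≤-refl
    exists-first n@(suc _) with bounded n (s≤s z≤n)
    ... | m , isR@(_ , rc , _) , m≤ =
      m ∸ n , IsR⇒FirstRepeat x (subst (IsR x n) (sym n+p≡m) isR) ,
      +-cancelˡ-≤ n _ _ (≤-trans (≤-reflexive n+p≡m) (≤-trans m≤ (≤-reflexive (sym (n+[1+n]≡2n+1 n)))))
      where
      n+p≡m : n + (m ∸ n) ≡ m
      n+p≡m = m+[n∸m]≡n (RCond⇒≤ x rc)
    R : ℕ → ℕ
    R n = proj₁ (exists-first n)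
    first : ∀ n → FirstRepeat x n (R n)
    first n = proj₁ (proj₂ (exists-first n))
    R≤ : ∀ n → R n ≤ suc n
    R≤ n = proj₂ (proj₂ (exists-first n))
    firstN : FirstRepeat x N (suc N)
    firstN = IsR⇒FirstRepeat x (subst (IsR x N) (sym (n+[1+n]≡2n+1 N)) isR)
    RN : R N ≡ suc N
    RN = ≤-antisym (R≤ N) (proj₂ firstN (R N) (proj₁ (first N)))
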